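{- $R(\mathcal{P}(3),\mathcal{P}(3))=7$.
   Context: $\mathcal{P}(d)$ is the power set of $[d]$ ordered by inclusion. A poset $R$ contains a copy of $F$ if there is an injective map $\phi:F\to R$ with $x\le_F y\Rightarrow\phi(x)\le_R\phi(y)$. The poset Ramsey number $R(P,Q)$ is the least $N$ such that every colouring of the elements of $\mathcal{P}(N)$ with colours $1,2$ contains a copy of $P$ in colour 1 or a copy of $Q$ in colour 2. -}

module Defs where

open import Data.Nat using (ℕ; _<_)
open import Relation.Nullary using (¬_)
open import Data.Fin.Subset using (Subset; _⊆_)
open import Data.Product using (Σ; _×_)
open import Relation.Binary.PropositionalEquality using (_≡_)
open import Function.Definitions using (Injective)

data Colour : Set where
  col₁ col₂ : Colour

-- 𝒫(d): subsets of [d] = Fin d, ordered by inclusion _⊆_.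
-- A 2-colouring of the elements of 𝒫(N).
Colouring : ℕ → Set
Colouring N = Subset N → Colour

CopyIn : (d N : ℕ) → Colouring N → Colour → Set
CopyIn d N col c =
  Σ (Subset d → Subset N) λ φ →
    Injective _≡_ _≡_ φ ×
    (∀ x y → x ⊆ y → φ x ⊆ φ y) ×
    (∀ x → col (φ x) ≡ c)

open import Data.Sum using (_⊎_)

RamseyProp : (p q N : ℕ) → Set
RamseyProp p q N = (col : Colouring N) → CopyIn p N col col₁ ⊎ CopyIn q N col col₂

PosetRamseyIs : (p q R : ℕ) → Set
PosetRamseyIs p q R = RamseyProp p q R × (∀ N → N < R → ¬ RamseyProp p q N)

{-# OPTIONS --safe #-}
module Submission where

-- Upper bound.  If three atoms have the colour of ∅, a short case analysis (`ThreeAtoms`) finds a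
-- copy, and dually for coatoms and the full set.  Otherwise some atom {i} differs in colour from
-- ∅ and some coatom [7] ∖ {j}, with j ≠ i, differs from [7].  The open interval between them is
-- 𝒫(5) without its ends, and every 2-colouring of that contains a monochromatic six-crown
-- (`Crown`); whichever colour the crown has, one of ∅, {i} and one of [7], [7] ∖ {j} complete it
-- to a cube.
--
-- Lower bound.  Colour levels 1, 2 and 5 of 𝒫(6) red, levels 0, 4 and 6 blue, and level 3 by a
-- 2-(6,3,2) design in which the complement of a block is a non-block.  Each colour meets only four
-- levels, so the levels of a copy are forced.  At level 3, either the sets of a red copy or the
-- complements of those of a blue one are blocks {i,j,k}, {i,j,l}, {i,k,l}, i.e. a triangle in the
-- link of i; but that link is a 5-cycle.

open import Defs
open import Data.Bool using (Bool; true; false; if_then_else_; _xor_)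
import Data.Bool.Properties as Bool
open import Data.Fin using (Fin; zero; suc; inject₁; _↑ˡ_; opposite; _<_)
open import Data.Fin.Patterns
open import Data.Fin.Permutation
  using (Permutation′; transpose; reverse; flip; _∘ₚ_; _⟨$⟩ʳ_; _⟨$⟩ˡ_; inverseˡ)
open import Data.Fin.Properties using (all?; any?; ¬∀⟶∃¬; _<?_)
open import Data.Fin.Subset
open import Data.Fin.Subset.Properties
  using (_⊆?_; drop-∷-⊆; s⊆s; out⊆; ⊆-refl; p⊆q⇒∁p⊇∁q; ∁p⊆∁q⇒p⊇q; ⊆-antisym; ⊆-reflexive)
open import Data.List using (List; []; _∷_; cartesianProductWith)
open import Data.List.Membership.DecPropositional using (_∈?_)
import Data.List.Membership.Propositional as List
open import Data.List.Relation.Unary.All as All using (All; []; _∷_)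
open import Data.Nat using (ℕ; zero; suc; s≤s⁻¹; _≤′_; ≤′-refl; ≤′-step)
import Data.Nat.Properties as ℕ
open import Data.Product using (∃; _×_; _,_; proj₁; proj₂)
open import Data.Sum as Sum using (_⊎_; inj₁; inj₂; [_,_]′)
open import Data.Vec using ([]; _∷_; here; lookup; tabulate; _∷ʳ_)
open import Data.Vec.Properties
  using (≡-dec; ∷-injectiveʳ; lookup∘tabulate; tabulate∘lookup; tabulate-cong; []=⇒lookup; lookup⇒[]=)
open import Function using (_∘_; _$_; case_of_)
open import Function.Definitions using (Injective)
open import Relation.Binary using (DecidableEquality)
open import Relation.Binary.PropositionalEquality
  using (_≡_; _≢_; refl; sym; trans; cong; module ≡-Reasoning)
open import Relation.Nullary using (Dec; yes; no; does; ¬_; contradiction)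
open import Relation.Nullary.Decidable
  using (map′; ¬?; _×-dec_; _⊎-dec_; _→-dec_; True; toWitness; from-yes)
open import Relation.Unary using (Pred; Decidable)

private variable
  d k m n : ℕ

-- Decidable properties of maps between power sets.

_≟ˢ_ : DecidableEquality (Subset n)
_≟ˢ_ = ≡-dec Bool._≟_

_≟ᶜ_ : DecidableEquality Colour
col₁ ≟ᶜ col₁ = yes refl
col₁ ≟ᶜ col₂ = no λ ()
col₂ ≟ᶜ col₁ = no λ ()
col₂ ≟ᶜ col₂ = yes refl

other : Colour → Colour
other col₁ = col₂
other col₂ = col₁

≢⇒other : ∀ {x c} → x ≢ c → x ≡ other c
≢⇒other {col₁} {col₁} x≢c = contradiction refl x≢c
≢⇒other {col₁} {col₂} x≢c = refl
≢⇒other {col₂} {col₁} x≢c = refl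
≢⇒other {col₂} {col₂} x≢c = contradiction refl x≢c

allSubsets? : ∀ {ℓ} {P : Pred (Subset n) ℓ} → Decidable P → Dec (∀ p → P p)
allSubsets? {zero}  P? = map′ (λ { p [] → p }) (_$ []) (P? [])
allSubsets? {suc n} P? =
  map′ (λ { (p , q) (outside ∷ x) → p x ; (p , q) (inside ∷ x) → q x })
       (λ p → p ∘ (outside ∷_) , p ∘ (inside ∷_))
       (allSubsets? (P? ∘ (outside ∷_)) ×-dec allSubsets? (P? ∘ (inside ∷_)))

Monotone : (Subset m → Subset n) → Set
Monotone φ = ∀ x y → x ⊆ y → φ x ⊆ φ y

-- Across the two halves only the covers `outside ∷ x ⊆ inside ∷ x` are tested; transitivity gives
-- the rest.
monotone? : (φ : Subset k → Subset n) → Dec (Monotone φ)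
monotone? {k = zero}  φ = yes λ { [] [] _ i∈p → i∈p }
monotone? {k = suc k} φ = map′ glue split
  (monotone? (φ ∘ (outside ∷_)) ×-dec monotone? (φ ∘ (inside ∷_)) ×-dec
   allSubsets? λ x → φ (outside ∷ x) ⊆? φ (inside ∷ x))
  where
  glue : Monotone (φ ∘ (outside ∷_)) × Monotone (φ ∘ (inside ∷_)) ×
         (∀ x → φ (outside ∷ x) ⊆ φ (inside ∷ x)) → Monotone φ
  glue (o , i , c) (outside ∷ x) (outside ∷ y) x⊆y = o x y (drop-∷-⊆ x⊆y)
  glue (o , i , c) (outside ∷ x) (inside  ∷ y) x⊆y = i x y (drop-∷-⊆ x⊆y) ∘ c x
  glue (o , i , c) (inside  ∷ x) (outside ∷ y) x⊆y = case x⊆y here of λ ()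
  glue (o , i , c) (inside  ∷ x) (inside  ∷ y) x⊆y = i x y (drop-∷-⊆ x⊆y)

  split : Monotone φ → Monotone (φ ∘ (outside ∷_)) × Monotone (φ ∘ (inside ∷_)) ×
                       (∀ x → φ (outside ∷ x) ⊆ φ (inside ∷ x))
  split mono = (λ x y x⊆y → mono _ _ (s⊆s x⊆y)) , (λ x y x⊆y → mono _ _ (s⊆s x⊆y)) ,
               λ x → mono _ _ (out⊆ ⊆-refl)

injective? : (φ : Subset k → Subset n) → Dec (Injective _≡_ _≡_ φ)
injective? {k = zero}  φ = yes λ { {[]} {[]} _ → refl }
injective? {k = suc k} φ = map′ glue split
  (injective? (φ ∘ (outside ∷_)) ×-dec injective? (φ ∘ (inside ∷_)) ×-dec
   allSubsets? λ x → allSubsets? λ y → ¬? (φ (outside ∷ x) ≟ˢ φ (inside ∷ y)))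
  where
  glue : Injective _≡_ _≡_ (φ ∘ (outside ∷_)) × Injective _≡_ _≡_ (φ ∘ (inside ∷_)) ×
         (∀ x y → φ (outside ∷ x) ≢ φ (inside ∷ y)) → Injective _≡_ _≡_ φ
  glue (o , i , c) {outside ∷ x} {outside ∷ y} eq = cong (outside ∷_) (o eq)
  glue (o , i , c) {outside ∷ x} {inside  ∷ y} eq = contradiction eq (c x y)
  glue (o , i , c) {inside  ∷ x} {outside ∷ y} eq = contradiction (sym eq) (c y x)
  glue (o , i , c) {inside  ∷ x} {inside  ∷ y} eq = cong (inside ∷_) (i eq)

  split : Injective _≡_ _≡_ φ →
          Injective _≡_ _≡_ (φ ∘ (outside ∷_)) × Injective _≡_ _≡_ (φ ∘ (inside ∷_)) ×
          (∀ x y → φ (outside ∷ x) ≢ φ (inside ∷ y))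
  split inj = ∷-injectiveʳ ∘ inj , ∷-injectiveʳ ∘ inj , λ x y eq → case inj eq of λ ()

-- Transport of copies: embeddings, complements, permutations.

copy-map : (col : Colouring n) {c : Colour} (ρ : Subset m → Subset n) →
           Monotone ρ → Injective _≡_ _≡_ ρ → CopyIn d m (col ∘ ρ) c → CopyIn d n col c
copy-map col ρ mono inj (φ , φ-inj , φ-mono , φ-col) =
  ρ ∘ φ , φ-inj ∘ inj , (λ x y x⊆y → mono _ _ (φ-mono x y x⊆y)) , φ-col

∁-injective : Injective _≡_ _≡_ (∁ {n})
∁-injective eq = ⊆-antisym (∁p⊆∁q⇒p⊇q (⊆-reflexive (sym eq))) (∁p⊆∁q⇒p⊇q (⊆-reflexive eq))

-- Complementing in the source as well undoes the reversal of the order.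
copy-dual : (col : Colouring n) {c : Colour} → CopyIn d n (col ∘ ∁) c → CopyIn d n col c
copy-dual col (φ , φ-inj , φ-mono , φ-col) =
  ∁ ∘ φ ∘ ∁ , ∁-injective ∘ φ-inj ∘ ∁-injective ,
  (λ x y x⊆y → p⊆q⇒∁p⊇∁q (φ-mono _ _ (p⊆q⇒∁p⊇∁q x⊆y))) , φ-col ∘ ∁

relabel : Permutation′ n → Subset n → Subset n
relabel π s = tabulate (lookup s ∘ (π ⟨$⟩ˡ_))

relabel-mono : (π : Permutation′ n) → Monotone (relabel π)
relabel-mono π x y x⊆y {i} i∈ = lookup⇒[]= i _ (trans (lookup∘tabulate _ i) ([]=⇒lookup (x⊆y
  (lookup⇒[]= (π ⟨$⟩ˡ i) x (trans (sym (lookup∘tabulate _ i)) ([]=⇒lookup i∈))))))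

relabel-flip : (π : Permutation′ n) (s : Subset n) → relabel (flip π) (relabel π s) ≡ s
relabel-flip π s = begin
  tabulate (lookup (relabel π s) ∘ (π ⟨$⟩ʳ_))  ≡⟨ tabulate-cong (lookup∘tabulate _ ∘ (π ⟨$⟩ʳ_)) ⟩
  tabulate (λ i → lookup s (π ⟨$⟩ˡ (π ⟨$⟩ʳ i))) ≡⟨ tabulate-cong (λ _ → cong (lookup s) (inverseˡ π)) ⟩
  tabulate (lookup s)                           ≡⟨ tabulate∘lookup s ⟩
  s                                             ∎
  where open ≡-Reasoning

relabel-injective : (π : Permutation′ n) → Injective _≡_ _≡_ (relabel π)
relabel-injective π {x} {y} eq =
  trans (sym (relabel-flip π x)) (trans (cong (relabel (flip π)) eq) (relabel-flip π y))

Mono : Colouring n → Set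
Mono {n} col = ∃ (CopyIn 3 n col)

mono-relabel : (col : Colouring n) (π : Permutation′ n) → Mono (col ∘ relabel π) → Mono col
mono-relabel col π (c , copy) = c , copy-map col (relabel π) (relabel-mono π) (relabel-injective π) copy

-- Decision trees that find a monochromatic cube.

-- A decision tree against an unknown colouring; `ask s y n` continues with `y` if `s` has the
-- reference colour and with `n` if it has the other one.
data Strategy (n : ℕ) : Set where
  claim : (Subset 3 → Subset n) → Strategy n
  ask   : Subset n → Strategy n → Strategy n → Strategy n

-- `ts` and `fs` are the sets known to have the reference colour and the other colour.
Wins : (ts fs : List (Subset n)) → Strategy n → Set
Wins ts fs (claim φ)   = ((∀ x → φ x List.∈ ts) ⊎ (∀ x → φ x List.∈ fs)) ×
                         Monotone φ × Injective _≡_ _≡_ φ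
Wins ts fs (ask s σ τ) = Wins (s ∷ ts) fs σ × Wins ts (s ∷ fs) τ

wins? : (ts fs : List (Subset n)) (σ : Strategy n) → Dec (Wins ts fs σ)
wins? ts fs (claim φ) =
  (allSubsets? (λ x → _∈?_ _≟ˢ_ (φ x) ts) ⊎-dec allSubsets? (λ x → _∈?_ _≟ˢ_ (φ x) fs)) ×-dec
  monotone? φ ×-dec injective? φ
wins? ts fs (ask s σ τ) = wins? (s ∷ ts) fs σ ×-dec wins? ts (s ∷ fs) τ

wins⇒mono : (col : Colouring n) (c : Colour) {ts fs : List (Subset n)} (σ : Strategy n) →
            Wins ts fs σ → All (λ s → col s ≡ c) ts → All (λ s → col s ≡ other c) fs → Mono col
wins⇒mono col c (claim φ) (known , φ-mono , φ-inj) Ts Fs = [ copy Ts , copy Fs ]′ known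
  where
  copy : ∀ {e us} → All (λ s → col s ≡ e) us → (∀ x → φ x List.∈ us) → Mono col
  copy Us φ∈us = _ , φ , φ-inj , φ-mono , λ x → All.lookup Us (φ∈us x)
wins⇒mono col c (ask s σ τ) (wσ , wτ) Ts Fs with col s ≟ᶜ c
... | yes p = wins⇒mono col c σ wσ (p ∷ Ts) Fs
... | no ¬p = wins⇒mono col c τ wτ Ts (≢⇒other ¬p ∷ Fs)

-- The hypothesis is about `does`, so that `refl` is checked by evaluating a Boolean.
run : (ts fs : List (Subset n)) (σ : Strategy n) → does (wins? ts fs σ) ≡ true →
      (col : Colouring n) (c : Colour) →
      All (λ s → col s ≡ c) ts → All (λ s → col s ≡ other c) fs → Mono col
run ts fs σ eq col c with yes w ← wins? ts fs σ = wins⇒mono col c σ w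

seek : Bool → List (Subset n) → (Subset n → Strategy n) → Strategy n → Strategy n
seek e     []       found none = none
seek true  (s ∷ ss) found none = ask s (found s) (seek true ss found none)
seek false (s ∷ ss) found none = ask s (seek false ss found none) (found s)

-- `u`, `v`, `w` are the images of the pairs 12, 13, 23.
cube : (b x y z u v w t : Subset n) → Subset 3 → Subset n
cube b x y z u v w t (outside ∷ outside ∷ outside ∷ []) = b
cube b x y z u v w t (inside  ∷ outside ∷ outside ∷ []) = x
cube b x y z u v w t (outside ∷ inside  ∷ outside ∷ []) = y
cube b x y z u v w t (outside ∷ outside ∷ inside  ∷ []) = z
cube b x y z u v w t (inside  ∷ inside  ∷ outside ∷ []) = u
cube b x y z u v w t (inside  ∷ outside ∷ inside  ∷ []) = v
cube b x y z u v w t (outside ∷ inside  ∷ inside  ∷ []) = w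
cube b x y z u v w t (inside  ∷ inside  ∷ inside  ∷ []) = t

cubeOn : (b p q r : Subset n) → Subset 3 → Subset n
cubeOn b p q r = cube b (b ∪ p) (b ∪ q) (b ∪ r) (b ∪ p ∪ q) (b ∪ p ∪ r) (b ∪ q ∪ r) (b ∪ p ∪ q ∪ r)

allOf : (Subset 3 → Subset n) → List (Subset n)
allOf φ = cartesianProductWith (λ x f → f x) sides
  (cartesianProductWith (λ y z x → φ (x ∷ y ∷ z ∷ [])) sides sides)
  where sides = outside ∷ inside ∷ []

-- Three atoms of the colour of ∅.

-- Played when ⊥ and the atoms `a`, `b`, `d` have the reference colour.
module ThreeAtoms (a b d p q r s : Subset n) where

  M : Subset n
  M = a ∪ b ∪ d

  -- In both uses the set found for a pair of atoms omits the third atom, so `u`, `v`, `w` are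
  -- distinct.
  copyBelow : (t : Subset n) → (Subset n → (Subset n → Strategy n) → Strategy n) → Strategy n
  copyBelow t find = find (a ∪ b) λ u → find (a ∪ d) λ v → find (b ∪ d) λ w → claim (cube ⊥ a b d u v w t)

  -- For `e` a union of two of the atoms, either some cube [e, e ∪ x ∪ y ∪ z] has only the other
  -- colour, or each of the three contains a set of the reference colour, and these lie below `t`.
  high : (x y z t : Subset n) → Strategy n → Strategy n
  high x y z t = ask t $ copyBelow t λ e found →
    seek true (allOf (cubeOn e x y z)) found (claim (cubeOn e x y z))

  -- Played when `M` joined with any three or four of the letters is known to have the other colour.
  middle : (x y z w : Subset n) → Strategy n → Strategy n
  middle x y z w = ask (M ∪ x ∪ y) $ copyBelow (M ∪ x ∪ y) λ e found →
    seek true (e ∷ e ∪ x ∷ e ∪ y ∷ []) found $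
    seek false (M ∷ M ∪ x ∷ [])
      (λ f → claim (cube e (e ∪ x) (e ∪ y) f
                         (M ∪ x ∪ y ∪ z) (M ∪ x ∪ z ∪ w) (M ∪ x ∪ y ∪ w) (M ∪ x ∪ y ∪ z ∪ w))) $
    ask (M ∪ y)
      (claim (cube ⊥ a b d M (M ∪ x) (M ∪ y) (M ∪ x ∪ y)))
      (claim (cube e (e ∪ x) (e ∪ y) (M ∪ y)
                   (M ∪ x ∪ y ∪ z) (M ∪ x ∪ y ∪ w) (M ∪ y ∪ z ∪ w) (M ∪ x ∪ y ∪ z ∪ w)))

  -- By now `M ∪ p` joined with any further letters, at least one, has the other colour. These are
  -- seven sets of a cube, whose bottom may be any set of the other colour inside `M`.
  low : Strategy n
  low = seek false (M ∷ a ∪ b ∷ a ∪ d ∷ b ∪ d ∷ [])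
    (λ e → claim (cube e (M ∪ p ∪ q) (M ∪ p ∪ r) (M ∪ p ∪ s)
                       (M ∪ p ∪ q ∪ r) (M ∪ p ∪ q ∪ s) (M ∪ p ∪ r ∪ s) (M ∪ p ∪ q ∪ r ∪ s)))
    (claim (cube ⊥ a b d (a ∪ b) (a ∪ d) (b ∪ d) M))

  strategy : Strategy n
  strategy =
    high p q r (M ∪ p ∪ q ∪ r ∪ s) $
    high p q r (M ∪ p ∪ q ∪ r) $ high p q s (M ∪ p ∪ q ∪ s) $
    high p r s (M ∪ p ∪ r ∪ s) $ high q r s (M ∪ q ∪ r ∪ s) $
    middle p q r s $ middle p r q s $ middle p s q r $
    low

three-atoms : (col : Colouring 7) → (∀ (i : Fin 3) → col ⁅ i ↑ˡ 4 ⁆ ≡ col ⊥) → Mono col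
three-atoms col h =
  run (⊥ ∷ ⁅ 0F ⁆ ∷ ⁅ 1F ⁆ ∷ ⁅ 2F ⁆ ∷ []) [] strategy refl col (col ⊥) (refl ∷ h 0F ∷ h 1F ∷ h 2F ∷ []) []
  where open ThreeAtoms ⁅ 0F ⁆ ⁅ 1F ⁆ ⁅ 2F ⁆ ⁅ 3F ⁆ ⁅ 4F ⁆ ⁅ 5F ⁆ ⁅ 6F ⁆

odd-atom : (col : Colouring 7) → Mono col ⊎ ∃ λ (i : Fin 3) → col ⁅ i ↑ˡ 4 ⁆ ≢ col ⊥
odd-atom col with all? (λ (i : Fin 3) → col ⁅ i ↑ˡ 4 ⁆ ≟ᶜ col ⊥)
... | yes h = inj₁ (three-atoms col h)
... | no ¬h = inj₂ (¬∀⟶∃¬ 3 _ (λ i → col ⁅ i ↑ˡ 4 ⁆ ≟ᶜ col ⊥) ¬h)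

-- Monochromatic crowns.

-- `lo e` and `hi e` are the ends that complete a crown to a cube; `e` tells whether the crown has the
-- reference colour.
module Crown (lo hi : Bool → Subset n) where

  ring : Bool → (x y z u v w : Subset n) → Strategy n
  ring e x y z u v w = claim (cube (lo e) x y z u v w (hi e))

  -- Played when `a`, `b`, `d` have the reference colour and [a ∪ b, a ∪ b ∪ p ∪ q] the other one.
  blocked : (a b d p q : Subset n) → Strategy n
  blocked a b d p q =
    ask Mp
      (ask Mq
        (seek false (p ∷ a ∪ p ∷ [])
          (λ x → seek false (q ∷ a ∪ q ∷ [])
            (λ y → ring false (a ∪ b) x y (a ∪ b ∪ p) (a ∪ b ∪ q) (a ∪ b ∪ p ∪ q))
            (ring true a b q Mp (a ∪ q) Mq))
          (ring true a b p Mq (a ∪ p) Mp))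
        (lopsided p q))
      (ask Mq
        (lopsided q p)
        -- Copies need not be induced, so the comparable sets `a ∪ b` and `a ∪ b ∪ p` may share a
        -- level.
        (ring false (a ∪ b) (a ∪ b ∪ p) (a ∪ b ∪ q) Mp Mq (a ∪ b ∪ p ∪ q)))
    where
    Mp = a ∪ b ∪ d ∪ p
    Mq = a ∪ b ∪ d ∪ q

    -- Played when `a ∪ b ∪ d ∪ x` has the reference colour and `a ∪ b ∪ d ∪ y` the other one.
    lopsided : (x y : Subset n) → Strategy n
    lopsided x y = seek false (x ∷ a ∪ x ∷ b ∪ x ∷ [])
      (λ z → ring false (a ∪ b) (a ∪ b ∪ y) z (a ∪ b ∪ d ∪ y) (a ∪ b ∪ x) (a ∪ b ∪ p ∪ q))
      (ring true a b x (a ∪ b ∪ d ∪ x) (a ∪ x) (b ∪ x))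

  strategy : (a b d p q : Subset n) → Strategy n
  strategy a b d p q =
    find (a ∪ b) (blocked a b d p q) λ u →
    find (a ∪ d) (blocked a d b p q) λ v →
    find (b ∪ d) (blocked b d a p q) λ w →
    ring true a b d u v w
    where
    find : Subset n → Strategy n → (Subset n → Strategy n) → Strategy n
    find e none found = seek true (e ∷ e ∪ p ∷ e ∪ q ∷ e ∪ p ∪ q ∷ []) found none

-- `choose s t x e` is the one of `s`, `t` that has the reference colour (`e = true`) or the other
-- colour (`e = false`), where `x` tells whether that of `s` is the reference colour.
choose : Subset n → Subset n → Bool → Bool → Subset n
choose s t x e = if x xor e then t else s

chosen : (col : Colouring n) (c : Colour) (s t : Subset n) → col s ≢ col t →
         ∃ λ x → col (choose s t x true) ≡ c × col (choose s t x false) ≡ other c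
chosen col c s t s≢t with col s ≟ᶜ c
... | yes refl = true , refl , ≢⇒other (s≢t ∘ sym)
... | no s≢c with col t ≟ᶜ c
...   | yes t≡c = false , t≡c , ≢⇒other s≢c
...   | no t≢c = contradiction (trans (≢⇒other s≢c) (sym (≢⇒other t≢c))) s≢t

-- The atoms of the copy of 𝒫(5) between `⁅ 0F ⁆` and `∁ ⁅ 6F ⁆`.
pair : Fin 5 → Subset 7
pair i = ⁅ 0F ⁆ ∪ ⁅ suc (inject₁ i) ⁆

bottoms tops : Bool → Bool → Subset 7
bottoms = choose ⊥ ⁅ 0F ⁆
tops    = choose ⊤ (∁ ⁅ 6F ⁆)

sames others : (x y : Bool) → List (Subset 7)
sames  x y = bottoms x true ∷ tops y true ∷ pair 0F ∷ pair 1F ∷ pair 2F ∷ []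
others x y = bottoms x false ∷ tops y false ∷ []

crownGame : (x y : Bool) → Strategy 7
crownGame x y = Crown.strategy (bottoms x) (tops y) (pair 0F) (pair 1F) (pair 2F) (pair 3F) (pair 4F)

crownGame-wins : ∀ x y → does (wins? (sames x y) (others x y) (crownGame x y)) ≡ true
crownGame-wins false false = refl
crownGame-wins false true  = refl
crownGame-wins true  false = refl
crownGame-wins true  true  = refl

play-crown : (col : Colouring 7) (c : Colour) →
             col (pair 0F) ≡ c → col (pair 1F) ≡ c → col (pair 2F) ≡ c →
             (∃ λ x → col (bottoms x true) ≡ c × col (bottoms x false) ≡ other c) →
             (∃ λ y → col (tops y true) ≡ c × col (tops y false) ≡ other c) → Mono col
play-crown col c p q r (x , lt , lf) (y , ht , hf) =
  run (sames x y) (others x y) (crownGame x y) (crownGame-wins x y) col c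
      (lt ∷ ht ∷ p ∷ q ∷ r ∷ []) (lf ∷ hf ∷ [])

crossed-alike : (col : Colouring 7) → col ⊥ ≢ col ⁅ 0F ⁆ → col ⊤ ≢ col (∁ ⁅ 6F ⁆) →
                col (pair 0F) ≡ col (pair 1F) → col (pair 1F) ≡ col (pair 2F) → Mono col
crossed-alike col h₀ h₆ p q = play-crown col (col (pair 1F)) p refl (sym q)
  (chosen col _ ⊥ ⁅ 0F ⁆ h₀) (chosen col _ ⊤ (∁ ⁅ 6F ⁆) h₆)

-- Pigeonhole on the pairs, and relabelling.

ThreeAlike : Subset 5 → Set
ThreeAlike v = ∃ λ x → ∃ λ y → ∃ λ z →
               (x < y × y < z) × lookup v x ≡ lookup v y × lookup v y ≡ lookup v z

three-alike : ∀ v → ThreeAlike v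
three-alike = from-yes (allSubsets? λ v → any? λ (x : Fin 5) → any? λ (y : Fin 5) → any? λ (z : Fin 5) →
  (x <? y ×-dec y <? z) ×-dec lookup v x Bool.≟ lookup v y ×-dec lookup v y Bool.≟ lookup v z)

-- For x < y < z, no transposition moves a letter that an earlier one has put in its place.
spread : (x y z : Fin 5) → Permutation′ 7
spread x y z = transpose 3F (suc (inject₁ z)) ∘ₚ transpose 2F (suc (inject₁ y)) ∘ₚ transpose 1F (suc (inject₁ x))

spread-sets : ∀ x y z → x < y × y < z → let ρ = relabel (spread x y z) in
              (ρ ⁅ 0F ⁆ ≡ ⁅ 0F ⁆ × ρ (∁ ⁅ 6F ⁆) ≡ ∁ ⁅ 6F ⁆ × ρ ⊥ ≡ ⊥ × ρ ⊤ ≡ ⊤) ×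
              ρ (pair 0F) ≡ pair x × ρ (pair 1F) ≡ pair y × ρ (pair 2F) ≡ pair z
spread-sets = from-yes (all? λ x → all? λ y → all? λ z → let ρ = relabel (spread x y z) in
  (x <? y ×-dec y <? z) →-dec
  (ρ ⁅ 0F ⁆ ≟ˢ ⁅ 0F ⁆ ×-dec ρ (∁ ⁅ 6F ⁆) ≟ˢ ∁ ⁅ 6F ⁆ ×-dec ρ ⊥ ≟ˢ ⊥ ×-dec ρ ⊤ ≟ˢ ⊤) ×-dec
  ρ (pair 0F) ≟ˢ pair x ×-dec ρ (pair 1F) ≟ˢ pair y ×-dec ρ (pair 2F) ≟ˢ pair z)

isCol₁ : Colour → Bool
isCol₁ col₁ = true
isCol₁ col₂ = false

isCol₁-injective : Injective _≡_ _≡_ isCol₁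
isCol₁-injective {col₁} {col₁} _ = refl
isCol₁-injective {col₂} {col₂} _ = refl

crossed-via : (col : Colouring 7) (π : Permutation′ 7) (let ρ = relabel π) → ∀ {i j o f x y z} →
              (ρ ⁅ 0F ⁆ ≡ i × ρ (∁ ⁅ 6F ⁆) ≡ j × ρ ⊥ ≡ o × ρ ⊤ ≡ f) ×
              ρ (pair 0F) ≡ x × ρ (pair 1F) ≡ y × ρ (pair 2F) ≡ z →
              col o ≢ col i → col f ≢ col j → col x ≡ col y → col y ≡ col z → Mono col
crossed-via col π ((refl , refl , refl , refl) , refl , refl , refl) h₀ h₆ xy yz =
  mono-relabel col π (crossed-alike (col ∘ relabel π) h₀ h₆ xy yz)

crossed : (col : Colouring 7) → col ⊥ ≢ col ⁅ 0F ⁆ → col ⊤ ≢ col (∁ ⁅ 6F ⁆) → Mono col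
crossed col h₀ h₆ = conclude (three-alike (tabulate bits))
  where
  bits = isCol₁ ∘ col ∘ pair

  alike : ∀ {i j} → lookup (tabulate bits) i ≡ lookup (tabulate bits) j → col (pair i) ≡ col (pair j)
  alike {i} {j} eq = isCol₁-injective
    (trans (sym (lookup∘tabulate bits i)) (trans eq (lookup∘tabulate bits j)))

  conclude : ThreeAlike (tabulate bits) → Mono col
  conclude (x , y , z , x<y<z , xy , yz) =
    crossed-via col (spread x y z) (spread-sets x y z x<y<z) h₀ h₆ (alike xy) (alike yz)

-- Duality and the upper bound.

-- With the reversal, `odd-atom` for the dual colouring misses one of the last three elements, so
-- never the element of the odd atom.
dual : Subset 7 → Subset 7
dual = ∁ ∘ relabel reverse

-- `opposite (j ↑ˡ 4)` is 6 - j, the element that `dual ⁅ j ↑ˡ 4 ⁆` misses. Since i ≤ 2 and 6 - j ≥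
-- 4, the two transpositions do not interfere.
swap : (i j : Fin 3) → Permutation′ 7
swap i j = transpose 0F (i ↑ˡ 4) ∘ₚ transpose 6F (opposite (j ↑ˡ 4))

swap-sets : ∀ i j → let ρ = relabel (swap i j) in
            ρ ⁅ 0F ⁆ ≡ ⁅ i ↑ˡ 4 ⁆ × ρ (∁ ⁅ 6F ⁆) ≡ dual ⁅ j ↑ˡ 4 ⁆ × ρ ⊥ ≡ ⊥ × ρ ⊤ ≡ dual ⊥
swap-sets = from-yes (all? λ i → all? λ j → let ρ = relabel (swap i j) in
  ρ ⁅ 0F ⁆ ≟ˢ ⁅ i ↑ˡ 4 ⁆ ×-dec ρ (∁ ⁅ 6F ⁆) ≟ˢ dual ⁅ j ↑ˡ 4 ⁆ ×-dec ρ ⊥ ≟ˢ ⊥ ×-dec ρ ⊤ ≟ˢ dual ⊥)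

mono-via : (col : Colouring 7) (π : Permutation′ 7) (let ρ = relabel π) → ∀ {i j o f} →
           ρ ⁅ 0F ⁆ ≡ i × ρ (∁ ⁅ 6F ⁆) ≡ j × ρ ⊥ ≡ o × ρ ⊤ ≡ f →
           col i ≢ col o → col j ≢ col f → Mono col
mono-via col π (refl , refl , refl , refl) h₀ h₆ =
  mono-relabel col π (crossed (col ∘ relabel π) (h₀ ∘ sym) (h₆ ∘ sym))

mono-7 : (col : Colouring 7) → Mono col
mono-7 col with odd-atom col | odd-atom (col ∘ dual)
... | inj₁ copy       | _               = copy
... | inj₂ _          | inj₁ (c , copy) =
  c , copy-dual col (copy-map (col ∘ ∁) (relabel reverse) (relabel-mono reverse) (relabel-injective reverse) copy)
... | inj₂ (i , odd₀) | inj₂ (j , odd₆) = mono-via col (swap i j) (swap-sets i j) odd₀ odd₆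

upper : RamseyProp 3 3 7
upper col with mono-7 col
... | col₁ , copy = inj₁ copy
... | col₂ , copy = inj₂ copy

-- Lower bound.

_⊊_ : Subset n → Subset n → Set
s ⊊ t = s ⊆ t × s ≢ t

_⊊?_ : (s t : Subset n) → Dec (s ⊊ t)
s ⊊? t = s ⊆? t ×-dec ¬? (s ≟ˢ t)

-- Quantifying over a maximal chain of the cube first prunes the exhaustive search early.
CubeFree : Colouring n → Colour → Set
CubeFree col c =
  ∀ b → col b ≡ c → ∀ x → col x ≡ c × b ⊊ x → ∀ u → col u ≡ c × x ⊊ u → ∀ t → col t ≡ c × u ⊊ t →
  ∀ y → col y ≡ c × y ≢ x × b ⊊ y × y ⊊ u → ∀ v → col v ≡ c × v ≢ u × x ⊊ v × v ⊊ t →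
  ∀ w → col w ≡ c × w ≢ u × w ≢ v × y ⊊ w × w ⊊ t →
  ∀ z → ¬ (col z ≡ c × z ≢ x × z ≢ y × b ⊊ z × z ⊊ v × z ⊊ w)

cubeFree? : (col : Colouring n) (c : Colour) → Dec (CubeFree col c)
cubeFree? col c =
  allSubsets? λ b → col b ≟ᶜ c →-dec
  allSubsets? λ x → (col x ≟ᶜ c ×-dec b ⊊? x) →-dec
  allSubsets? λ u → (col u ≟ᶜ c ×-dec x ⊊? u) →-dec
  allSubsets? λ t → (col t ≟ᶜ c ×-dec u ⊊? t) →-dec
  allSubsets? λ y → (col y ≟ᶜ c ×-dec ¬? (y ≟ˢ x) ×-dec b ⊊? y ×-dec y ⊊? u) →-dec
  allSubsets? λ v → (col v ≟ᶜ c ×-dec ¬? (v ≟ˢ u) ×-dec x ⊊? v ×-dec v ⊊? t) →-dec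
  allSubsets? λ w → (col w ≟ᶜ c ×-dec ¬? (w ≟ˢ u) ×-dec ¬? (w ≟ˢ v) ×-dec y ⊊? w ×-dec w ⊊? t) →-dec
  allSubsets? λ z → ¬? (col z ≟ᶜ c ×-dec ¬? (z ≟ˢ x) ×-dec ¬? (z ≟ˢ y) ×-dec
                        b ⊊? z ×-dec z ⊊? v ×-dec z ⊊? w)

cubeFree⇒¬copy : (col : Colouring n) (c : Colour) → does (cubeFree? col c) ≡ true → ¬ CopyIn 3 n col c
cubeFree⇒¬copy col c eq (φ , φ-inj , φ-mono , φ-col) with yes free ← cubeFree? col c =
  free (φ ⊥) (φ-col _) (φ x) (φ-col _ , lt) (φ u) (φ-col _ , lt) (φ ⊤) (φ-col _ , lt)
       (φ y) (φ-col _ , ne , lt , lt) (φ v) (φ-col _ , ne , lt , lt)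
       (φ w) (φ-col _ , ne , ne , lt , lt) (φ z) (φ-col _ , ne , ne , lt , lt , lt)
  where
  x y z u v w : Subset 3
  x = ⁅ 0F ⁆
  y = ⁅ 1F ⁆
  z = ⁅ 2F ⁆
  u = ∁ z
  v = ∁ y
  w = ∁ x

  ne : ∀ {s t} {s≢t : True (¬? (s ≟ˢ t))} → φ s ≢ φ t
  ne {s≢t = s≢t} = toWitness s≢t ∘ φ-inj

  lt : ∀ {s t} {s⊊t : True (s ⊊? t)} → φ s ⊊ φ t
  lt {s⊊t = s⊊t} = φ-mono _ _ (proj₁ (toWitness s⊊t)) , proj₂ (toWitness s⊊t) ∘ φ-inj

-- The triples of colour `col₁` form the 2-(6,3,2) design with blocks {i, i+1, ∞} and
-- {i, i+1, i+3} for i ∈ ℤ/5; the point ∞ comes first.  They are exactly the triples that contain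
-- a single pair {i, i+1}.
designColouring : Colouring 6
designColouring s@(_ ∷ r@(i ∷ is)) with ∣ s ∣
... | 1 = col₁
... | 2 = col₁
... | 3 = if does (∣ r ∩ (is ∷ʳ i) ∣ ℕ.≟ 1) then col₁ else col₂
... | 5 = col₁
... | _ = col₂

¬ramsey-6 : ¬ RamseyProp 3 3 6
¬ramsey-6 ramsey =
  [ cubeFree⇒¬copy designColouring col₁ refl , cubeFree⇒¬copy designColouring col₂ refl ]′
    (ramsey designColouring)

-- The sets that omit the first element form a copy of 𝒫(n). Hence refuting 6 refutes every smaller
-- number.
ramsey-step : RamseyProp d k n → RamseyProp d k (suc n)
ramsey-step ramsey col = Sum.map extend extend (ramsey (col ∘ (outside ∷_)))
  where
  extend : ∀ {e c} → CopyIn e _ (col ∘ (outside ∷_)) c → CopyIn e _ col c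
  extend = copy-map col (outside ∷_) (λ _ _ → s⊆s) ∷-injectiveʳ

ramsey-mono : m ≤′ n → RamseyProp d k m → RamseyProp d k n
ramsey-mono ≤′-refl       = λ ramsey → ramsey
ramsey-mono (≤′-step m≤n) = ramsey-step ∘ ramsey-mono m≤n

theorem17 : PosetRamseyIs 3 3 7
theorem17 = upper , λ N N<7 → ¬ramsey-6 ∘ ramsey-mono (ℕ.≤⇒≤′ (s≤s⁻¹ N<7))
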